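{- Let $r\ge 1$ be an integer. The order of a $[1,r;4]$-mixed cage is $2(r+2)$. Moreover, a mixed graph $H$ is a $[1,r;4]$-mixed cage if and only if it is obtained from the complete bipartite graph $K_{r+2,r+2}$ by choosing a $2$-factor $F$ of $K_{r+2,r+2}$, orienting every cycle of $F$ as a directed cycle (these become the arcs of $H$), and keeping all remaining edges of $K_{r+2,r+2}$ as undirected edges.
   Context: A mixed graph is a finite simple graph that may contain both edges and arcs. A $[z,r;g]$-mixed graph is a mixed graph in which every vertex is the tail of exactly $z$ arcs, the head of exactly $z$ arcs, and is incident with exactly $r$ edges, and whose girth is $g$. Walks traverse edges in either direction and arcs only in their direction; a cycle is a closed walk with no repeated vertices (other than start = end) and no repeated edge or arc; the girth is the length of a shortest cycle. A $[z,r;g]$-mixed cage is a $[z,r;g]$-mixed graph of minimum order. -}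

module Defs where

open import Data.Bool using (Bool; true; false; T; not; _∧_; _∨_)
open import Data.Empty using (⊥)
open import Data.Fin using (Fin)
open import Data.List using (List; []; _∷_; map; length)
open import Data.List.Relation.Unary.All using (All)
open import Data.List.Relation.Unary.AllPairs using (AllPairs)
open import Data.List.Relation.Unary.Unique.Propositional using (Unique)
open import Data.Nat using (ℕ; _≤_)
open import Data.Product using (_×_; _,_; ∃; ∃₂; ∃-syntax; proj₁; proj₂)
open import Data.Sum using (_⊎_; inj₁; inj₂)
open import Function.Base using (_∘_)
open import Function.Bundles using (_↔_; Inverse)
open import Relation.Binary.Construct.Closure.ReflexiveTransitive using (Star; ε; _◅_)
open import Relation.Binary.Definitions using (Symmetric; Irreflexive; Asymmetric)
open import Relation.Binary.PropositionalEquality using (_≡_; refl)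
open import Relation.Nullary using (¬_)

-- Since T (p x) has at most one element, the Σ-type counts each x once.
HasSize : {V : Set} → (V → Bool) → ℕ → Set
HasSize p k = ∃ (T ∘ p) ↔ Fin k

record SimpleGraph (V : Set) : Set where
  field
    adj : V → V → Bool

  Adj : V → V → Set
  Adj u v = T (adj u v)

  field
    adj-sym    : Symmetric Adj
    adj-irrefl : Irreflexive _≡_ Adj

-- Simplicity: two distinct vertices are joined by at most one edge or arc, so
-- opposite arcs and an arc parallel to an edge are excluded.
record MixedGraph (V : Set) : Set where
  field
    edge : V → V → Bool
    arc  : V → V → Bool

  Edge : V → V → Set
  Edge u v = T (edge u v)

  Arc : V → V → Set
  Arc u v = T (arc u v)

  field
    edge-sym    : Symmetric Edge
    edge-irrefl : Irreflexive _≡_ Edge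
    arc-asym    : Asymmetric Arc
    disjoint    : ∀ {u v} → Edge u v → ¬ Arc u v

  data Step (u v : V) : Set where
    byEdge : Edge u v → Step u v
    byArc  : Arc u v → Step u v

  Walk : V → V → Set
  Walk = Star Step

  steps : ∀ {u v} → Walk u v → List (∃₂ Step)
  steps ε       = []
  steps (s ◅ w) = (_ , _ , s) ∷ steps w

  walkLength : ∀ {u v} → Walk u v → ℕ
  walkLength = length ∘ steps

  -- The endpoint of the walk is not listed.
  tails : ∀ {u v} → Walk u v → List V
  tails = map proj₁ ∘ steps

  -- An edge is an unordered pair, so it may be traversed in two ways.
  SameLink : ∃₂ Step → ∃₂ Step → Set
  SameLink (u , v , byEdge _) (x , y , byEdge _) = (u ≡ x × v ≡ y) ⊎ (u ≡ y × v ≡ x)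
  SameLink (u , v , byArc _)  (x , y , byArc _)  = u ≡ x × v ≡ y
  SameLink (_ , _ , byEdge _) (_ , _ , byArc _)  = ⊥
  SameLink (_ , _ , byArc _)  (_ , _ , byEdge _) = ⊥

  record IsCycle {u : V} (w : Walk u u) : Set where
    field
      nonempty          : 1 ≤ walkLength w
      distinct-vertices : Unique (tails w)
      distinct-links    : AllPairs (λ s t → ¬ SameLink s t) (steps w)

  HasGirth : ℕ → Set
  HasGirth g =
    (∃[ u ] ∃[ w ] IsCycle {u} w × walkLength w ≡ g) ×
    (∀ {u} (w : Walk u u) → IsCycle w → g ≤ walkLength w)

record IsMixedRegular {V : Set} (z r g : ℕ) (G : MixedGraph V) : Set where
  open MixedGraph G
  field
    out-degree  : ∀ u → HasSize (λ v → arc u v) z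
    in-degree   : ∀ u → HasSize (λ v → arc v u) z
    edge-degree : ∀ u → HasSize (λ v → edge u v) r
    girth       : HasGirth g

IsMixedCage : (z r g : ℕ) {n : ℕ} → MixedGraph (Fin n) → Set
IsMixedCage z r g {n} G =
  IsMixedRegular z r g G ×
  (∀ {n′} (G′ : MixedGraph (Fin n′)) → IsMixedRegular z r g G′ → n ≤ n′)

record _≅_ {V W : Set} (G : MixedGraph V) (H : MixedGraph W) : Set where
  private
    module G = MixedGraph G
    module H = MixedGraph H
  field
    bijection : V ↔ W
  open Inverse bijection using (to)
  field
    edge-preserved : ∀ u v → G.edge u v ≡ H.edge (to u) (to v)
    arc-preserved  : ∀ u v → G.arc u v ≡ H.arc (to u) (to v)

K : (p q : ℕ) → SimpleGraph (Fin p ⊎ Fin q)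
K p q = record
  { adj        = across
  ; adj-sym    = λ {u} {v} → across-sym u v
  ; adj-irrefl = λ { {u} refl → across-irrefl u }
  }
  where
  across : Fin p ⊎ Fin q → Fin p ⊎ Fin q → Bool
  across (inj₁ _) (inj₁ _) = false
  across (inj₁ _) (inj₂ _) = true
  across (inj₂ _) (inj₁ _) = true
  across (inj₂ _) (inj₂ _) = false

  across-sym : ∀ u v → T (across u v) → T (across v u)
  across-sym (inj₁ _) (inj₂ _) t = t
  across-sym (inj₂ _) (inj₁ _) t = t

  across-irrefl : ∀ u → ¬ T (across u u)
  across-irrefl (inj₁ _) ()
  across-irrefl (inj₂ _) ()

undirected : {V : Set} → SimpleGraph V → MixedGraph V
undirected G = record
  { edge        = adj
  ; arc         = λ _ _ → false
  ; edge-sym    = λ {u} {v} → adj-sym {u} {v}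
  ; edge-irrefl = adj-irrefl
  ; arc-asym    = λ ()
  ; disjoint    = λ _ ()
  }
  where open SimpleGraph G

record IsTwoFactor {V : Set} (G F : SimpleGraph V) : Set where
  private
    module G = SimpleGraph G
    module F = SimpleGraph F
  field
    subgraph    : ∀ {u v} → F.Adj u v → G.Adj u v
    two-regular : ∀ u → HasSize (F.adj u) 2

-- H is G with the 2-factor F replaced by arcs.  By arc-asym in H, each edge of
-- F receives exactly one direction; a cycle of F has become a directed cycle
-- when its arcs all agree, or all disagree, with the direction of traversal.
record IsFactorOrientation {V : Set} (G F : SimpleGraph V) (H : MixedGraph V) : Set where
  private
    module G = SimpleGraph G
    module F = SimpleGraph F
    module C = MixedGraph (undirected F)
    module H = MixedGraph H
  field
    two-factor      : IsTwoFactor G F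
    arcs-orient     : ∀ u v → F.adj u v ≡ H.arc u v ∨ H.arc v u
    cycles-directed : ∀ {u} (w : C.Walk u u) → C.IsCycle w →
      All (λ (x , y , _) → H.Arc x y) (C.steps w) ⊎
      All (λ (x , y , _) → H.Arc y x) (C.steps w)
    edges-remaining : ∀ u v → H.edge u v ≡ G.adj u v ∧ not (F.adj u v)

ObtainedByOrienting : {V W : Set} → SimpleGraph W → MixedGraph V → Set
ObtainedByOrienting {W = W} G H =
  ∃[ F ] ∃[ M ] IsFactorOrientation {W} G F M × H ≅ M

{-# OPTIONS --safe #-}
module Submission where

-- When every vertex has one out-arc and one in-arc, each triangle of the underlying simple
-- graph can be traversed as a mixed cycle, so girth 4 makes that graph triangle-free and
-- (r + 2)-regular. Two adjacent vertices then have disjoint neighbourhoods of size r + 2,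
-- and if these are all the vertices, the graph is K_{r+2,r+2}. The arcs form a 2-factor,
-- and no two consecutive arcs on one of its cycles can clash. Conversely, K_{r+2,r+2} has
-- no cycle of length less than 4, any directed path of three arcs closes up to a mixed
-- 4-cycle, and each vertex has one out-arc and one in-arc because it lies on a cycle of the
-- finite 2-regular graph F, which has become a directed cycle.

open import Data.Bool using (Bool; true; false; T; T?; not; _∧_; _∨_)
open import Data.Bool.Properties using (T-irrelevant; T-∨; ∨-comm; ∧-inverseʳ)
open import Data.Empty using (⊥-elim)
open import Data.Fin using (Fin; zero; suc; _≟_; fromℕ; inject₁; _↑ʳ_)
open import Data.Fin.Permutation using (↔⇒≡)
open import Data.Fin.Properties using (injective⇒≤; +↔⊎; suc-injective)
open import Data.Fin.Relation.Unary.Top using (view; view-fromℕ; view-inject₁; ‵fromℕ; ‵inject₁)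
open import Data.List using (List; []; _∷_; length; lookup; filter; allFin)
open import Data.List.Membership.Propositional using (_∈_; _∉_)
open import Data.List.Membership.Propositional.Properties using (∈-lookup; ∈-filter⁺; ∈-filter⁻; ∈-allFin)
import Data.List.Membership.DecPropositional as DecMembership
open import Data.List.Relation.Unary.All as All using (All; []; _∷_)
open import Data.List.Relation.Unary.All.Properties using (¬Any⇒All¬; All¬⇒¬Any)
open import Data.List.Relation.Unary.AllPairs using (AllPairs; []; _∷_)
open import Data.List.Relation.Unary.Any using (here; there; index)
open import Data.List.Relation.Unary.Any.Properties using (lookup-index)
open import Data.List.Relation.Unary.Unique.Propositional using (Unique)
import Data.List.Relation.Unary.Unique.Propositional.Properties as Unique
open import Data.Nat using (ℕ; zero; suc; _+_; _*_; _≤_; z≤n; s≤s)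
open import Data.Nat.Properties
  using (≤-antisym; ≤-trans; ≤-reflexive; <-irrefl; <⇒≱; m≤n⇒m≤1+n; m≤m+n; +-comm; +-suc; +-identityʳ;
         +-cancelʳ-≡)
open import Data.Product using (_×_; _,_; ∃; ∃₂; ∃-syntax; Σ-syntax; proj₁; proj₂)
open import Data.Sum using (_⊎_; inj₁; inj₂; [_,_]′; swap)
open import Function.Base using (_∘_)
open import Function.Bundles using (_↔_; _⇔_; Inverse; Equivalence; mk↔ₛ′; mk⇔)
open import Function.Construct.Composition using (_↔-∘_)
open import Function.Construct.Identity using (↔-id)
open import Function.Construct.Symmetry using (↔-sym)
open import Function.Definitions using (Injective)
open import Function.Properties.Inverse using (↔⇒↣)
open import Relation.Binary.Construct.Closure.ReflexiveTransitive using (ε; _◅_)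
open import Relation.Binary.Definitions using (DecidableEquality)
open import Relation.Binary.PropositionalEquality using (_≡_; _≢_; refl; sym; trans; cong; cong₂; subst)
open import Relation.Nullary using (¬_; yes; no; contradiction)
open import Relation.Nullary.Decidable using (⌊_⌋; toWitness; fromWitness; via-injection)
open import Defs

private
  variable
    V W : Set
    p q : V → Bool
    j k r : ℕ

-- Sizes of decidable subsets

lookup-injective : {xs : List V} → Unique xs → Injective _≡_ _≡_ (lookup xs)
lookup-injective (_  ∷ _) {zero}  {zero}  _  = refl
lookup-injective (x∉ ∷ _) {zero}  {suc j} eq = contradiction eq (All.lookup x∉ (∈-lookup j))
lookup-injective (x∉ ∷ _) {suc i} {zero}  eq = contradiction (sym eq) (All.lookup x∉ (∈-lookup i))
lookup-injective (_  ∷ u) {suc i} {suc j} eq = cong suc (lookup-injective u eq)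

↔-injective : (ψ : V ↔ W) → Injective _≡_ _≡_ (Inverse.to ψ)
↔-injective ψ {x} {y} eq =
  trans (sym (strictlyInverseʳ x)) (trans (cong from eq) (strictlyInverseʳ y))
  where open Inverse ψ

Unique⇒length≤ : V ↔ Fin k → {xs : List V} → Unique xs → length xs ≤ k
Unique⇒length≤ ψ u = injective⇒≤ (lookup-injective u ∘ ↔-injective ψ)

∃T-≡ : {a b : ∃ (T ∘ p)} → proj₁ a ≡ proj₁ b → a ≡ b
∃T-≡ {a = x , s} {b = .x , t} refl = cong (x ,_) (T-irrelevant s t)

-- Surjectivity supplies the inverse, and membership proofs are unique, so a size can be established
-- by looking at the elements alone.
enumeration⇒HasSize : (f : Fin k → V) → (∀ i → T (p (f i))) → Injective _≡_ _≡_ f →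
  (∀ {x} → T (p x) → ∃[ i ] f i ≡ x) → HasSize p k
enumeration⇒HasSize f f∈p inj surj = mk↔ₛ′
  (λ (x , t) → proj₁ (surj t))
  (λ i → f i , f∈p i)
  (λ i → inj (proj₂ (surj (f∈p i))))
  (λ (x , t) → ∃T-≡ (proj₂ (surj t)))

module Enumeration {V : Set} {p : V → Bool} {k} (h : HasSize p k) where
  open Inverse h

  element : Fin k → V
  element i = proj₁ (from i)

  element-∈ : ∀ i → T (p (element i))
  element-∈ i = proj₂ (from i)

  element-injective : Injective _≡_ _≡_ element
  element-injective eq = ↔-injective (↔-sym h) (∃T-≡ eq)

  element-surjective : ∀ {x} → T (p x) → ∃[ i ] element i ≡ x
  element-surjective {x} t = to (x , t) , cong proj₁ (strictlyInverseʳ (x , t))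

open Enumeration

HasSize-unique : HasSize p j → HasSize p k → j ≡ k
HasSize-unique h h′ = ↔⇒≡ (h′ ↔-∘ ↔-sym h)

HasSize-preimage : (ψ : V ↔ W) → (∀ x → p x ≡ q (Inverse.to ψ x)) → HasSize q k → HasSize p k
HasSize-preimage {p = p} {q = q} ψ p≡q h = enumeration⇒HasSize
  (from ∘ element h)
  (λ i → subst T (sym (p≡q _)) (subst (T ∘ q) (sym (strictlyInverseˡ _)) (element-∈ h i)))
  (element-injective h ∘ ↔-injective (↔-sym ψ))
  λ {x} t → let i , eq = element-surjective h (subst T (p≡q x) t) in
    i , trans (cong from eq) (strictlyInverseʳ x)
  where open Inverse ψ

HasSize-mono : HasSize p j → HasSize q k → (∀ {x} → T (p x) → T (q x)) → j ≤ k
HasSize-mono {j = j} {k = k} hp hq p⊆q = injective⇒≤ {f = f} f-injective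
  where
  f : Fin j → Fin k
  f i = proj₁ (element-surjective hq (p⊆q (element-∈ hp i)))

  f-injective : Injective _≡_ _≡_ f
  f-injective {a} {b} eq = element-injective hp
    (trans (sym (proj₂ (element-surjective hq (p⊆q (element-∈ hp a)))))
      (trans (cong (element hq) eq) (proj₂ (element-surjective hq (p⊆q (element-∈ hp b))))))

HasSize-∨ : HasSize p j → HasSize q k → (∀ {x} → T (p x) → ¬ T (q x)) →
  HasSize (λ x → p x ∨ q x) (j + k)
HasSize-∨ {p = p} {j = j} {q = q} {k = k} hp hq p∩q=∅ = enumeration⇒HasSize
  (f ∘ to) (f∈ ∘ to) (↔-injective +↔⊎ ∘ f-injective) surj
  where
  open Inverse (+↔⊎ {j} {k})
  f : Fin j ⊎ Fin k → _
  f = [ element hp , element hq ]′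

  f∈ : ∀ i → T (p (f i) ∨ q (f i))
  f∈ (inj₁ i) = Equivalence.from T-∨ (inj₁ (element-∈ hp i))
  f∈ (inj₂ i) = Equivalence.from T-∨ (inj₂ (element-∈ hq i))

  f-injective : Injective _≡_ _≡_ f
  f-injective {inj₁ a} {inj₁ b} eq = cong inj₁ (element-injective hp eq)
  f-injective {inj₂ a} {inj₂ b} eq = cong inj₂ (element-injective hq eq)
  f-injective {inj₁ a} {inj₂ b} eq =
    contradiction (element-∈ hq b) (p∩q=∅ (subst (T ∘ p) eq (element-∈ hp a)))
  f-injective {inj₂ a} {inj₁ b} eq =
    contradiction (element-∈ hq a) (p∩q=∅ (subst (T ∘ p) (sym eq) (element-∈ hp b)))

  surj : ∀ {x} → T (p x ∨ q x) → ∃[ i ] f (to i) ≡ x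
  surj t with Equivalence.to T-∨ t
  ... | inj₁ px = let i , eq = element-surjective hp px in
    from (inj₁ i) , trans (cong f (strictlyInverseˡ (inj₁ i))) eq
  ... | inj₂ qx = let i , eq = element-surjective hq qx in
    from (inj₂ i) , trans (cong f (strictlyInverseˡ (inj₂ i))) eq

HasSize-singleton : (_≟_ : DecidableEquality V) → ∀ x → HasSize (λ y → ⌊ x ≟ y ⌋) 1
HasSize-singleton _≟_ x = enumeration⇒HasSize {k = 1} (λ _ → x)
  (λ _ → fromWitness {a? = x ≟ x} refl) (λ { {zero} {zero} _ → refl })
  (λ {y} t → zero , toWitness {a? = x ≟ y} t)

-- Otherwise p together with an element of q outside p would have k + 1 elements inside q.
HasSize-⊆⇒⊇ : DecidableEquality V → {p q : V → Bool} → HasSize p k → HasSize q k →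
  (∀ {x} → T (p x) → T (q x)) → ∀ {x} → T (q x) → T (p x)
HasSize-⊆⇒⊇ {k = k} _≟_ {p} {q} hp hq p⊆q {x} qx with T? (p x)
... | yes px = px
... | no ¬px =
  contradiction (HasSize-mono (HasSize-∨ (HasSize-singleton _≟_ x) hp x∉p) hq x∪p⊆q) (<-irrefl refl)
  where
  x∉p : ∀ {y} → T ⌊ x ≟ y ⌋ → ¬ T (p y)
  x∉p {y} t with refl ← toWitness {a? = x ≟ y} t = ¬px

  x∪p⊆q : ∀ {y} → T (⌊ x ≟ y ⌋ ∨ p y) → T (q y)
  x∪p⊆q {y} t with Equivalence.to T-∨ t
  ... | inj₂ py = p⊆q py
  ... | inj₁ e with refl ← toWitness {a? = x ≟ y} e = qx

HasSize-full : V ↔ Fin k → HasSize {V} (λ _ → true) k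
HasSize-full ψ = enumeration⇒HasSize from _ (↔-injective (↔-sym ψ)) (λ {x} _ → to x , strictlyInverseʳ x)
  where open Inverse ψ

-- This names a degree whose value is not known yet, so that it can be computed by cancellation.
HasSize-Fin : ∀ {n} (p : Fin n → Bool) → ∃ (HasSize p)
HasSize-Fin {n} p = length xs , enumeration⇒HasSize (lookup xs)
  (λ i → proj₂ (∈-filter⁻ (T? ∘ p) {xs = allFin n} (∈-lookup {xs = xs} i)))
  (lookup-injective (Unique.filter⁺ (T? ∘ p) (Unique.allFin⁺ n)))
  (λ {x} t → let x∈ = ∈-filter⁺ (T? ∘ p) (∈-allFin x) t in index x∈ , sym (lookup-index x∈))
  where xs = filter (T? ∘ p) (allFin n)

HasSize-1⇒inhabited : HasSize p 1 → ∃ (T ∘ p)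
HasSize-1⇒inhabited h = element h zero , element-∈ h zero

HasSize-1⇒unique : {p : V → Bool} → HasSize p 1 → ∀ {x y} → T (p x) → T (p y) → x ≡ y
HasSize-1⇒unique h s t with element-surjective h s | element-surjective h t
... | zero , eq | zero , eq′ = trans (sym eq) eq′

∃!⇒HasSize-1 : {x : V} → T (p x) → (∀ {y} → T (p y) → x ≡ y) → HasSize p 1
∃!⇒HasSize-1 {x = x} px unique = enumeration⇒HasSize {k = 1} (λ _ → x) (λ _ → px)
  (λ { {zero} {zero} _ → refl }) (λ py → zero , unique py)

-- In a 2-regular graph this gives the way to leave a vertex other than the one by which it was
-- entered.
HasSize-2⇒other : {p : V → Bool} → HasSize p 2 → ∀ {x} → T (p x) →
  ∃[ y ] T (p y) × y ≢ x × (∀ {z} → T (p z) → z ≡ x ⊎ z ≡ y)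
HasSize-2⇒other {p = p} h {x} px with element-surjective h px
... | i , refl = element h (flip i) , element-∈ h (flip i) , flip-≢ i ∘ element-injective h , cover
  where
  flip : Fin 2 → Fin 2
  flip zero = suc zero
  flip (suc zero) = zero

  flip-≢ : ∀ i → flip i ≢ i
  flip-≢ zero ()
  flip-≢ (suc zero) ()

  flip-cover : ∀ i l → l ≡ i ⊎ l ≡ flip i
  flip-cover zero       zero       = inj₁ refl
  flip-cover zero       (suc zero) = inj₂ refl
  flip-cover (suc zero) zero       = inj₂ refl
  flip-cover (suc zero) (suc zero) = inj₁ refl

  cover : ∀ {z} → T (p z) → z ≡ element h i ⊎ z ≡ element h (flip i)
  cover pz with element-surjective h pz
  ... | l , refl with flip-cover i l
  ...   | inj₁ refl = inj₁ refl
  ...   | inj₂ refl = inj₂ refl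

-- The first disjunct is explicit because unification does not recover it from the computed type
-- `T (x ∨ y)`.
T-∨⁻ : ∀ x {y} → T (x ∨ y) → T x ⊎ T y
T-∨⁻ _ = Equivalence.to T-∨

T-∨⁺ : ∀ x {y} → T x ⊎ T y → T (x ∨ y)
T-∨⁺ _ = Equivalence.from T-∨

T-⇔⇒≡ : ∀ {x y} → (T x → T y) → (T y → T x) → x ≡ y
T-⇔⇒≡ {true}  {true}  _ _ = refl
T-⇔⇒≡ {true}  {false} f _ = ⊥-elim (f _)
T-⇔⇒≡ {false} {true}  _ g = ⊥-elim (g _)
T-⇔⇒≡ {false} {false} _ _ = refl

∖-∨-cancel : ∀ x y → (T y → T x) → x ∧ not y ∨ y ≡ x
∖-∨-cancel true  true  _   = refl
∖-∨-cancel true  false _   = refl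
∖-∨-cancel false true  y⇒x = ⊥-elim (y⇒x _)
∖-∨-cancel false false _   = refl

-- The simple graph underlying a mixed graph

module Underlying {V : Set} (G : MixedGraph V) where
  open MixedGraph G

  arcs : V → V → Bool
  arcs u v = arc u v ∨ arc v u

  link : V → V → Bool
  link u v = edge u v ∨ arcs u v

  Link : V → V → Set
  Link u v = T (link u v)

  private
    variable
      u v w x y z : V

  arc⇒link : Arc u v → Link u v
  arc⇒link {u} {v} a = T-∨⁺ (edge u v) (inj₂ (T-∨⁺ (arc u v) (inj₁ a)))

  step⇒link : Step u v → Link u v
  step⇒link {u} {v} (byEdge e) = T-∨⁺ (edge u v) (inj₁ e)
  step⇒link (byArc a) = arc⇒link a

  link⇒step : Link u v → Step u v ⊎ Arc v u
  link⇒step {u} {v} l with T-∨⁻ (edge u v) l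
  ... | inj₁ e = inj₁ (byEdge e)
  ... | inj₂ a with T-∨⁻ (arc u v) a
  ...   | inj₁ uv = inj₁ (byArc uv)
  ...   | inj₂ vu = inj₂ vu

  arcs-sym : T (arcs u v) → T (arcs v u)
  arcs-sym {u} {v} = T-∨⁺ (arc v u) ∘ swap ∘ T-∨⁻ (arc u v)

  arc-irrefl : ¬ Arc u u
  arc-irrefl a = arc-asym a a

  arcs-irrefl : ¬ T (arcs u u)
  arcs-irrefl {u} = [ arc-irrefl , arc-irrefl ]′ ∘ T-∨⁻ (arc u u)

  edge∩arcs=∅ : Edge u v → ¬ T (arcs u v)
  edge∩arcs=∅ {u} {v} e = [ disjoint e , disjoint (edge-sym e) ]′ ∘ T-∨⁻ (arc u v)

  link-sym : Link u v → Link v u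
  link-sym {u} {v} = T-∨⁺ (edge v u) ∘ [ inj₁ ∘ edge-sym , inj₂ ∘ arcs-sym {u} {v} ]′ ∘ T-∨⁻ (edge u v)

  link-irrefl : ¬ Link u u
  link-irrefl {u} = [ edge-irrefl refl , arcs-irrefl ]′ ∘ T-∨⁻ (edge u u)

  link⇒≢ : Link u v → u ≢ v
  link⇒≢ l refl = link-irrefl l

  -- Edges and arcs are disjoint. Once the links are those of the complete bipartite graph, this
  -- becomes `edges-remaining`.
  edge≡link∖arcs : ∀ u v → edge u v ≡ link u v ∧ not (arcs u v)
  edge≡link∖arcs u v with edge u v | edge∩arcs=∅ {u} {v}
  ... | false | _ = sym (∧-inverseʳ (arcs u v))
  ... | true  | e∩a=∅ with arcs u v
  ...   | true  = ⊥-elim (e∩a=∅ _ _)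
  ...   | false = refl

  -- Simplicity leaves only the case of one edge walked back and forth, so no cycle has length two.
  opposite-steps : (s : Step u v) (t : Step v u) → SameLink (u , v , s) (v , u , t)
  opposite-steps (byEdge _) (byEdge _) = inj₂ (refl , refl)
  opposite-steps (byEdge e) (byArc a)  = ⊥-elim (disjoint (edge-sym e) a)
  opposite-steps (byArc a)  (byEdge e) = ⊥-elim (disjoint (edge-sym e) a)
  opposite-steps (byArc a)  (byArc b)  = ⊥-elim (arc-asym a b)

  SameLink⇒ : {s : Step u v} {t : Step x y} → SameLink (u , v , s) (x , y , t) →
    (u ≡ x × v ≡ y) ⊎ (u ≡ y × v ≡ x)
  SameLink⇒ {s = byEdge _} {byEdge _} e = e
  SameLink⇒ {s = byArc _}  {byArc _}  e = inj₁ e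

  -- Different tails exclude the same link in the same sense; the second hypothesis excludes its
  -- reversal.
  links-differ : {s : Step u v} {t : Step x y} → u ≢ x → u ≢ y ⊎ v ≢ x →
    ¬ SameLink (u , v , s) (x , y , t)
  links-differ {s = s} {t} u≢x d e with SameLink⇒ {s = s} {t} e | d
  ... | inj₁ (u≡x , _)   | _        = u≢x u≡x
  ... | inj₂ (u≡y , _)   | inj₁ u≢y = u≢y u≡y
  ... | inj₂ (_   , v≡x) | inj₂ v≢x = v≢x v≡x

  triangle : HasGirth 4 → Step x y → Step y z → ¬ Step z x
  triangle {x} {y} {z} (_ , shortest) s t q = contradiction (shortest (s ◅ t ◅ q ◅ ε) cycle)
    λ { (s≤s (s≤s (s≤s ()))) }
    where
    x≢y = link⇒≢ (step⇒link s)
    y≢z = link⇒≢ (step⇒link t)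
    z≢x = link⇒≢ (step⇒link q)
    x≢z = z≢x ∘ sym
    cycle : IsCycle (s ◅ t ◅ q ◅ ε)
    cycle = record
      { nonempty          = s≤s z≤n
      ; distinct-vertices = (x≢y ∷ x≢z ∷ []) ∷ (y≢z ∷ []) ∷ [] ∷ []
      ; distinct-links    =
          (links-differ {s = s} {t} x≢y (inj₁ x≢z) ∷ links-differ {s = s} {q} x≢z (inj₂ y≢z) ∷ []) ∷
          (links-differ {s = t} {q} y≢z (inj₁ (x≢y ∘ sym)) ∷ []) ∷ [] ∷ []
      }

  TriangleFree : Set
  TriangleFree = ∀ {x y z} → Link x y → Link y z → ¬ Link z x

  module _ (out-degree : ∀ u → HasSize (λ v → arc u v) 1)
           (in-degree  : ∀ u → HasSize (λ v → arc v u) 1) where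

    out-unique : Arc u v → Arc u w → v ≡ w
    out-unique = HasSize-1⇒unique (out-degree _)

    in-unique : Arc v u → Arc w u → v ≡ w
    in-unique = HasSize-1⇒unique (in-degree _)

    arcs-degree : ∀ u → HasSize (arcs u) 2
    arcs-degree u = HasSize-∨ (out-degree u) (in-degree u) arc-asym

    link-degree : (∀ u → HasSize (edge u) r) → ∀ u → HasSize (link u) (r + 2)
    link-degree edge-degree u = HasSize-∨ (edge-degree u) (arcs-degree u) edge∩arcs=∅

    module _ (girth : HasGirth 4) where

      -- A triangle with an arc y → x can only be traversed x, z, y: were one of its other
      -- two links an arc in the opposite sense, x or y would have two in- or out-arcs.
      no-triangle-on-arc : Arc y x → Link y z → ¬ Link z x
      no-triangle-on-arc yx yz zx with link⇒step (link-sym yz) | link⇒step (link-sym zx)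
      ... | inj₂ a | _      = link⇒≢ zx (sym (out-unique yx a))
      ... | _      | inj₂ a = link⇒≢ yz (in-unique yx a)
      ... | inj₁ s | inj₁ t = triangle girth (byArc yx) t s

      girth-4⇒triangle-free : TriangleFree
      girth-4⇒triangle-free xy yz zx with link⇒step xy | link⇒step yz | link⇒step zx
      ... | inj₁ s | inj₁ t | inj₁ q = triangle girth s t q
      ... | inj₂ a | _      | _      = no-triangle-on-arc a yz zx
      ... | _      | inj₂ a | _      = no-triangle-on-arc a zx xy
      ... | _      | _      | inj₂ a = no-triangle-on-arc a xy yz

    -- Any directed path of three arcs closes up, and out-degree 1 forbids the closing
    -- link from being an arc parallel to the path.
    triangle-free⇒girth-4 : V → TriangleFree →
      (∀ {w x y z} → Link w x → Link x y → Link y z → Link z w) → HasGirth 4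
    triangle-free⇒girth-4 u₀ triangle-free closing = four-cycle , no-shorter
      where
      no-shorter : ∀ {u} (w : Walk u u) → IsCycle w → 4 ≤ walkLength w
      no-shorter ε c = contradiction (IsCycle.nonempty c) λ ()
      no-shorter (s ◅ ε) c = ⊥-elim (link-irrefl (step⇒link s))
      no-shorter (s ◅ t ◅ ε) c with IsCycle.distinct-links c
      ... | (¬same ∷ []) ∷ _ = ⊥-elim (¬same (opposite-steps s t))
      no-shorter (s ◅ t ◅ q ◅ ε) c = ⊥-elim (triangle-free (step⇒link s) (step⇒link t) (step⇒link q))
      no-shorter (_ ◅ _ ◅ _ ◅ _ ◅ _) c = s≤s (s≤s (s≤s (s≤s z≤n)))

      next : V → V
      next u = proj₁ (HasSize-1⇒inhabited (out-degree u))

      next-arc : ∀ u → Arc u (next u)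
      next-arc u = proj₂ (HasSize-1⇒inhabited (out-degree u))

      four-cycle : ∃[ u ] ∃[ w ] IsCycle {u} w × walkLength w ≡ 4
      four-cycle = a , byArc ab ◅ byArc bc ◅ byArc cd ◅ da ◅ ε , cycle , refl
        where
        a = u₀
        b = next a
        c = next b
        d = next c
        ab = next-arc a
        bc = next-arc b
        cd = next-arc c
        a≢b = link⇒≢ (arc⇒link ab)
        b≢c = link⇒≢ (arc⇒link bc)
        c≢d = link⇒≢ (arc⇒link cd)

        a≢c : a ≢ c
        a≢c a≡c = arc-asym ab (subst (Arc b) (sym a≡c) bc)

        b≢d : b ≢ d
        b≢d b≡d = arc-asym bc (subst (Arc c) (sym b≡d) cd)

        link-da : Link d a
        link-da = closing (arc⇒link ab) (arc⇒link bc) (arc⇒link cd)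

        da : Step d a
        da with link⇒step link-da
        ... | inj₁ s  = s
        ... | inj₂ ad = contradiction (out-unique ab ad) b≢d

        a≢d = link⇒≢ link-da ∘ sym

        cycle : IsCycle (byArc ab ◅ byArc bc ◅ byArc cd ◅ da ◅ ε)
        cycle = record
          { nonempty          = s≤s z≤n
          ; distinct-vertices = (a≢b ∷ a≢c ∷ a≢d ∷ []) ∷ (b≢c ∷ b≢d ∷ []) ∷ (c≢d ∷ []) ∷ [] ∷ []
          ; distinct-links    =
              (a≢b ∘ proj₁ ∷ a≢c ∘ proj₁ ∷ links-differ {s = byArc ab} {da} a≢d (inj₂ b≢d) ∷ []) ∷
              (b≢c ∘ proj₁ ∷ links-differ {s = byArc bc} {da} b≢d (inj₁ (a≢b ∘ sym)) ∷ []) ∷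
              (links-differ {s = byArc cd} {da} c≢d (inj₁ (a≢c ∘ sym)) ∷ []) ∷ [] ∷ []
          }

open Underlying

underlying : MixedGraph V → SimpleGraph V
underlying G = record
  { adj        = link G
  ; adj-sym    = link-sym G
  ; adj-irrefl = λ { refl → link-irrefl G }
  }

-- Triangle-free regular graphs: order bound and the extremal case

module TriangleFreeRegular {n d : ℕ} (S : SimpleGraph (Fin n))
  (degree : ∀ u → HasSize (SimpleGraph.adj S u) d)
  (triangle-free : ∀ {x y z} → SimpleGraph.Adj S x y → SimpleGraph.Adj S y z → ¬ SimpleGraph.Adj S z x)
  {v₀ v₁ : Fin n} (v₀v₁ : SimpleGraph.Adj S v₀ v₁)
  where

  open SimpleGraph S

  neighbours : HasSize (λ x → adj v₀ x ∨ adj v₁ x) (d + d)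
  neighbours = HasSize-∨ (degree v₀) (degree v₁) (λ v₀x v₁x → triangle-free v₀v₁ v₁x (adj-sym v₀x))

  order-bound : d + d ≤ n
  order-bound = HasSize-mono neighbours (HasSize-full (↔-id (Fin n))) _

  module _ (n≡ : n ≡ d + d) where

    -- The two disjoint neighbourhoods already contain `d + d` vertices, which is all of them.
    cover : ∀ x → Adj v₀ x ⊎ Adj v₁ x
    cover x = T-∨⁻ (adj v₀ x) (HasSize-⊆⇒⊇ _≟_ (subst (HasSize _) (sym n≡) neighbours)
      (HasSize-full (↔-id (Fin n))) _ {x} _)

    -- A neighbour of `x` adjacent to `v₀` would close a triangle, so all neighbours of `x` are
    -- neighbours of `v₁`. Both sets have `d` elements, hence they coincide.
    across : ∀ {x y} → Adj v₀ x → Adj v₁ y → Adj x y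
    across {x} {y} v₀x v₁y = HasSize-⊆⇒⊇ _≟_ (degree x) (degree v₁) x⊆v₁ v₁y
      where
      x⊆v₁ : ∀ {z} → Adj x z → Adj v₁ z
      x⊆v₁ {z} xz with cover z
      ... | inj₁ v₀z = ⊥-elim (triangle-free v₀x xz (adj-sym v₀z))
      ... | inj₂ v₁z = v₁z

    -- The sides are the neighbourhoods of `v₀` and `v₁`. Each is independent because the graph is
    -- triangle-free, and `across` joins them completely.
    complete-bipartite : ∃[ ψ ] ∀ a b →
      adj (Inverse.from ψ a) (Inverse.from ψ b) ≡ SimpleGraph.adj (K d d) a b
    complete-bipartite = mk↔ₛ′ to from to∘from from∘to , links
      where
      from : Fin d ⊎ Fin d → Fin n
      from (inj₁ i) = element (degree v₀) i
      from (inj₂ i) = element (degree v₁) i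

      left : ∀ i → Adj v₀ (from (inj₁ i))
      left = element-∈ (degree v₀)

      right : ∀ i → Adj v₁ (from (inj₂ i))
      right = element-∈ (degree v₁)

      from-surjective : ∀ x → ∃[ a ] from a ≡ x
      from-surjective x with cover x
      ... | inj₁ l = let i , eq = element-surjective (degree v₀) l in inj₁ i , eq
      ... | inj₂ l = let i , eq = element-surjective (degree v₁) l in inj₂ i , eq

      from-injective : ∀ {a b} → from a ≡ from b → a ≡ b
      from-injective {inj₁ i} {inj₁ j} eq = cong inj₁ (element-injective (degree v₀) eq)
      from-injective {inj₂ i} {inj₂ j} eq = cong inj₂ (element-injective (degree v₁) eq)
      from-injective {inj₁ i} {inj₂ j} eq = ⊥-elim (adj-irrefl eq (across (left i) (right j)))
      from-injective {inj₂ i} {inj₁ j} eq = ⊥-elim (adj-irrefl (sym eq) (across (left j) (right i)))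

      to : Fin n → Fin d ⊎ Fin d
      to x = proj₁ (from-surjective x)

      from∘to : ∀ x → from (to x) ≡ x
      from∘to x = proj₂ (from-surjective x)

      to∘from : ∀ a → to (from a) ≡ a
      to∘from a = from-injective (from∘to (from a))

      links : ∀ a b → adj (from a) (from b) ≡ SimpleGraph.adj (K d d) a b
      links (inj₁ i) (inj₁ j) = T-⇔⇒≡ (λ l → triangle-free (left i) l (adj-sym (left j))) λ ()
      links (inj₂ i) (inj₂ j) = T-⇔⇒≡ (λ l → triangle-free (right i) l (adj-sym (right j))) λ ()
      links (inj₁ i) (inj₂ j) = T-⇔⇒≡ _ (λ _ → across (left i) (right j))
      links (inj₂ i) (inj₁ j) = T-⇔⇒≡ _ (λ _ → adj-sym (across (left j) (right i)))

module RegularLowerBound {n r} {G : MixedGraph (Fin n)} (regular : IsMixedRegular 1 r 4 G) where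
  open IsMixedRegular regular

  private
    -- The cycle witnessing the girth ensures that there is a vertex at all; its out-arc serves as
    -- the base link.
    v₀ = proj₁ (proj₁ girth)

  open TriangleFreeRegular (underlying G)
    (link-degree G out-degree in-degree edge-degree)
    (girth-4⇒triangle-free G out-degree in-degree girth)
    (arc⇒link G (proj₂ (HasSize-1⇒inhabited (out-degree v₀))))
    using (order-bound; complete-bipartite) public

-- 2-factors and their orientations

-- A path ending in x is grown at its head, always leaving the head by the neighbour it was
-- not entered from. By 2-regularity the new vertex is fresh or equal to x; it must become x
-- before the vertices run out.
module TwoRegularCycle {W : Set} {N : ℕ} (enum : W ↔ Fin N) (F : SimpleGraph W)
  (two-regular : ∀ u → HasSize (SimpleGraph.adj F u) 2) where

  open SimpleGraph F
  open MixedGraph (undirected F) using (Step; byEdge; Walk; steps; tails; SameLink; IsCycle)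

  _≟W_ : DecidableEquality W
  _≟W_ = via-injection (↔⇒↣ enum) _≟_

  open DecMembership _≟W_ using (_∈?_)

  -- The path visits `v`, `u`, ..., `b`, `x` in this order; at the start `u` is `x` and `b` is `v`.
  -- Since `tails` omits the endpoint, `x` is added to the vertex lists by hand.
  record Path (x b v u : W) : Set where
    field
      vu             : Adj v u
      rest           : Walk u x
      unique         : Unique (x ∷ v ∷ tails rest)
      distinct-links : AllPairs (λ s t → ¬ SameLink s t) (steps (byEdge vu ◅ rest))
      last-step      : ∃[ s ] (b , x , s) ∈ steps (byEdge vu ◅ rest)
      -- The next two fields prevent the head from meeting the path anywhere but at x.
      inner-closed   : ∀ {y z} → y ∈ tails rest → Adj y z → z ∈ x ∷ v ∷ tails rest
      head-chordless : ∀ {y} → y ∈ tails rest → Adj v y → y ≡ u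

    vertices : List W
    vertices = x ∷ v ∷ tails rest

  -- A step leaving `x` and a step entering it are recorded: once the cycle is directed, they give
  -- an out-arc and an in-arc of `x`.
  CycleThrough : W → Set
  CycleThrough x = ∃[ w ] IsCycle {x} w × ∃₂ λ a b → ∃₂ λ s t →
    (x , a , s) ∈ steps w × (b , x , t) ∈ steps w

  steps-tails : ∀ {u v x y s} (w : Walk u v) → (x , y , s) ∈ steps w → x ∈ tails w
  steps-tails (_ ◅ w) (here refl) = here refl
  steps-tails (_ ◅ w) (there i)   = there (steps-tails w i)

  steps-heads : ∀ {u v x y s} (w : Walk u v) → (x , y , s) ∈ steps w → y ∈ v ∷ tails w
  steps-heads (_ ◅ ε)       (here refl) = here refl
  steps-heads (_ ◅ _ ◅ _)   (here refl) = there (there (here refl))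
  steps-heads (_ ◅ w)       (there i) with steps-heads w i
  ... | here eq = here eq
  ... | there j = there (there j)

  -- A step repeating the new link would either leave `z`, which is not a tail of `w`, or leave `u`
  -- towards `z`.
  extend-links : ∀ {u v z} (e : Adj z u) (w : Walk u v) → z ∉ tails w →
    (∀ {y t} → (u , y , t) ∈ steps w → z ≢ y) →
    All (λ t → ¬ SameLink (z , u , byEdge e) t) (steps w)
  extend-links {u} {v} {z} e w z∉w fresh = All.tabulate differ
    where
    differ : ∀ {t} → t ∈ steps w → ¬ SameLink (z , u , byEdge e) t
    differ {p , q , byEdge _} i (inj₁ (refl , _))   = z∉w (steps-tails w i)
    differ {p , q , byEdge _} i (inj₂ (z≡q , refl)) = fresh i z≡q

  first-step-unique : ∀ {u v x y t} (s : Step u v) (w : Walk v x) → u ∉ tails w →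
    (u , y , t) ∈ steps (s ◅ w) → y ≡ v
  first-step-unique s w u∉w (here refl) = refl
  first-step-unique s w u∉w (there i)   = ⊥-elim (u∉w (steps-tails w i))

  module _ {x b v u} (P : Path x b v u) where
    open Path P
    private
      w : Walk v x
      w = byEdge vu ◅ rest

      other = HasSize-2⇒other (two-regular v) vu

      v′ = proj₁ other

      vv′ : Adj v v′
      vv′ = proj₁ (proj₂ other)

      v′≢u : v′ ≢ u
      v′≢u = proj₁ (proj₂ (proj₂ other))

      neighbours : ∀ {z} → Adj v z → z ≡ u ⊎ z ≡ v′
      neighbours = proj₂ (proj₂ (proj₂ other))

      x∉w : x ∉ v ∷ tails rest
      x∉w with unique
      ... | h ∷ _ = All¬⇒¬Any h

      v∉rest : v ∉ tails rest
      v∉rest with unique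
      ... | _ ∷ h ∷ _ = All¬⇒¬Any h

      unique-w : Unique (v ∷ tails rest)
      unique-w with unique
      ... | _ ∷ h = h

      u∈vertices : u ∈ vertices
      u∈vertices = steps-heads w (here refl)

      no-step-to-v′ : ∀ {y t} → (v , y , t) ∈ steps w → v′ ≢ y
      no-step-to-v′ i v′≡y = v′≢u (trans v′≡y (first-step-unique (byEdge vu) rest v∉rest i))

    -- The closing link is new because the path leaves `v` only towards `u`, and `v′` is not `u`.
    close : v′ ≡ x → CycleThrough x
    close v′≡x = byEdge xv ◅ w , cycle , v , b , _ , _ , here refl , there (proj₂ last-step)
      where
      xv : Adj x v
      xv = subst (λ z → Adj z v) v′≡x (adj-sym vv′)

      cycle : IsCycle (byEdge xv ◅ w)
      cycle = record
        { nonempty          = s≤s z≤n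
        ; distinct-vertices = unique
        ; distinct-links    =
            extend-links xv w x∉w (λ i x≡y → no-step-to-v′ i (trans v′≡x x≡y)) ∷ distinct-links
        }

    -- The old head `v` becomes an inner vertex with both neighbours `u` and `v′` on the path. The
    -- new head has no earlier inner neighbour, since `inner-closed` would place `v′` on the old
    -- path.
    extend : v′ ∉ vertices → Path x b v′ v
    extend v′∉ = record
      { vu             = adj-sym vv′
      ; rest           = w
      ; unique         = (x≢v′ ∷ ¬Any⇒All¬ _ x∉w) ∷ (¬Any⇒All¬ _ (v′∉ ∘ there)) ∷ unique-w
      ; distinct-links = extend-links (adj-sym vv′) w (v′∉ ∘ there) no-step-to-v′ ∷ distinct-links
      ; last-step      = proj₁ last-step , there (proj₂ last-step)
      ; inner-closed   = closed
      ; head-chordless = λ where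
          (here y≡v) _   → y≡v
          (there i)  v′y → ⊥-elim (v′∉ (inner-closed i (adj-sym v′y)))
      }
      where
      x≢v′ : x ≢ v′
      x≢v′ x≡v′ = v′∉ (here (sym x≡v′))

      weaken : ∀ {z} → z ∈ vertices → z ∈ x ∷ v′ ∷ v ∷ tails rest
      weaken (here eq) = here eq
      weaken (there i) = there (there i)

      closed : ∀ {y z} → y ∈ v ∷ tails rest → Adj y z → z ∈ x ∷ v′ ∷ v ∷ tails rest
      closed (there i)   yz = weaken (inner-closed i yz)
      closed (here refl) yz with neighbours yz
      ... | inj₁ refl = weaken u∈vertices
      ... | inj₂ refl = there (here refl)

    -- The equation records growth by exactly one vertex, which pays for one unit of fuel in
    -- `search`.
    continue : CycleThrough x ⊎ ∃₂ λ v″ (Q : Path x b v″ v) → tails (Path.rest Q) ≡ v ∷ tails rest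
    continue with v′ ∈? vertices
    ... | no  v′∉                 = inj₂ (v′ , extend v′∉ , refl)
    ... | yes (here v′≡x)         = inj₁ (close v′≡x)
    ... | yes (there (here v′≡v)) = ⊥-elim (adj-irrefl (sym v′≡v) vv′)
    -- An inner vertex adjacent to the head can only be `u`, while `v′` is the other neighbour.
    ... | yes (there (there i))   = ⊥-elim (v′≢u (head-chordless i vv′))

  -- Without fuel, the tails of `rest` would number at least `N`; together with `x` and `v` this
  -- makes more than `N` distinct vertices.
  search : ∀ {x b v u} (fuel : ℕ) (P : Path x b v u) → N ≤ fuel + length (tails (Path.rest P)) →
    CycleThrough x
  search zero P N≤ = contradiction (Unique⇒length≤ enum (Path.unique P)) (<⇒≱ (s≤s (m≤n⇒m≤1+n N≤)))
  search (suc fuel) P N≤ with continue P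
  ... | inj₁ c = c
  ... | inj₂ (_ , Q , eq) = search fuel Q (≤-trans N≤ (≤-reflexive
    (trans (sym (+-suc fuel _)) (cong (λ l → fuel + length l) (sym eq)))))

  cycle-through : ∀ x → CycleThrough x
  cycle-through x = search N start (m≤m+n N 0)
    where
    xa : Adj x (element (two-regular x) zero)
    xa = element-∈ (two-regular x) zero

    start : Path x _ _ x
    start = record
      { vu             = adj-sym xa
      ; rest           = ε
      ; unique         = ((λ eq → adj-irrefl eq xa) ∷ []) ∷ [] ∷ []
      ; distinct-links = [] ∷ []
      ; last-step      = _ , here refl
      ; inner-closed   = λ ()
      ; head-chordless = λ ()
      }

module _ {W : Set} (M : MixedGraph W)
  (out-degree : ∀ u → HasSize (λ v → MixedGraph.arc M u v) 1)
  (in-degree  : ∀ u → HasSize (λ v → MixedGraph.arc M v u) 1)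
  (F : SimpleGraph W) (orients : ∀ u v → SimpleGraph.adj F u v ≡ arcs M u v)
  where
  open MixedGraph M using (Arc; arc)
  private
    module C = MixedGraph (undirected F)

    step⇒arc : ∀ {u v} → C.Step u v → Arc u v ⊎ Arc v u
    step⇒arc {u} {v} (C.byEdge e) = T-∨⁻ (arc u v) (subst T (orients u v) e)

  -- Two consecutive arcs with a common head (or a common tail) would be the same link.
  non-backtracking⇒directed : ∀ {u v} (w : C.Walk u v) →
    AllPairs (λ s t → ¬ C.SameLink s t) (C.steps w) →
    All (λ (x , y , _) → Arc x y) (C.steps w) ⊎ All (λ (x , y , _) → Arc y x) (C.steps w)
  non-backtracking⇒directed ε _ = inj₁ []
  non-backtracking⇒directed (s ◅ ε) _ with step⇒arc s
  ... | inj₁ a = inj₁ (a ∷ [])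
  ... | inj₂ a = inj₂ (a ∷ [])
  non-backtracking⇒directed (s@(C.byEdge _) ◅ t@(C.byEdge _) ◅ w) ((s≁t ∷ _) ∷ d)
    with step⇒arc s | non-backtracking⇒directed (t ◅ w) d
  ... | inj₁ a | inj₁ (b ∷ bs) = inj₁ (a ∷ b ∷ bs)
  ... | inj₂ a | inj₂ (b ∷ bs) = inj₂ (a ∷ b ∷ bs)
  ... | inj₁ a | inj₂ (b ∷ _)  = ⊥-elim (s≁t (inj₂ (in-unique M out-degree in-degree a b , refl)))
  ... | inj₂ a | inj₁ (b ∷ _)  = ⊥-elim (s≁t (inj₂ (out-unique M out-degree in-degree a b , refl)))

module Oriented {W : Set} {N : ℕ} (enum : W ↔ Fin N) {G F : SimpleGraph W} {M : MixedGraph W}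
  (orientation : IsFactorOrientation G F M) where
  open IsFactorOrientation orientation
  open IsTwoFactor two-factor
  open MixedGraph M using (Arc; arc; arc-asym)
  private
    module C = MixedGraph (undirected F)

    -- The cycle of `F` through `x` is directed. If its arcs oppose the traversal, the steps
    -- entering and leaving `x` exchange their roles.
    through : ∀ x → ∃₂ λ o i → Arc x o × Arc i x
    through x with TwoRegularCycle.cycle-through enum F two-regular x
    ... | w , cycle , a , b , _ , _ , xa , bx with cycles-directed w cycle
    ...   | inj₁ forward  = a , b , All.lookup forward xa , All.lookup forward bx
    ...   | inj₂ backward = b , a , All.lookup backward bx , All.lookup backward xa

    arc⇒adj : ∀ {x y} → T (arcs M x y) → SimpleGraph.Adj F x y
    arc⇒adj {x} {y} = subst T (sym (arcs-orient x y))

    outgoing : ∀ {x y} → Arc x y → SimpleGraph.Adj F x y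
    outgoing {x} {y} a = arc⇒adj (T-∨⁺ (arc x y) (inj₁ a))

    incoming : ∀ {x y} → Arc y x → SimpleGraph.Adj F x y
    incoming {x} {y} a = arc⇒adj (T-∨⁺ (arc x y) (inj₂ a))

  -- One of the two neighbours of `u` in `F` is the tail of an arc into `u`. By asymmetry every
  -- out-arc goes to the other one.
  out-degree : ∀ u → HasSize (λ v → arc u v) 1
  out-degree u with through u
  ... | o , i , uo , iu = ∃!⇒HasSize-1 uo unique
    where
    unique : ∀ {y} → Arc u y → o ≡ y
    unique uy with HasSize-2⇒other (two-regular u) (incoming iu)
    ... | o′ , _ , _ , cover with cover (outgoing uo) | cover (outgoing uy)
    ...   | inj₁ refl | _         = ⊥-elim (arc-asym iu uo)
    ...   | _         | inj₁ refl = ⊥-elim (arc-asym iu uy)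
    ...   | inj₂ refl | inj₂ refl = refl

  in-degree : ∀ u → HasSize (λ v → arc v u) 1
  in-degree u with through u
  ... | o , i , uo , iu = ∃!⇒HasSize-1 iu unique
    where
    unique : ∀ {y} → Arc y u → i ≡ y
    unique yu with HasSize-2⇒other (two-regular u) (outgoing uo)
    ... | i′ , _ , _ , cover with cover (incoming iu) | cover (incoming yu)
    ...   | inj₁ refl | _         = ⊥-elim (arc-asym iu uo)
    ...   | _         | inj₁ refl = ⊥-elim (arc-asym yu uo)
    ...   | inj₂ refl | inj₂ refl = refl

  -- The edges are `G` without `F`, and the arcs put `F`, a subgraph of `G`, back.
  link≡adj : ∀ u v → link M u v ≡ SimpleGraph.adj G u v
  link≡adj u v = trans (cong₂ _∨_ (edges-remaining u v) (sym (arcs-orient u v)))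
    (∖-∨-cancel (SimpleGraph.adj G u v) (SimpleGraph.adj F u v) subgraph)

-- Relabelling of mixed graphs

comap : (V → W) → MixedGraph W → MixedGraph V
comap f M = record
  { edge        = λ u v → edge (f u) (f v)
  ; arc         = λ u v → arc (f u) (f v)
  ; edge-sym    = edge-sym
  ; edge-irrefl = λ { refl → edge-irrefl refl }
  ; arc-asym    = arc-asym
  ; disjoint    = disjoint
  }
  where open MixedGraph M

comap-≅ : (ψ : V ↔ W) (M : MixedGraph W) → comap (Inverse.to ψ) M ≅ M
comap-≅ ψ M = record
  { bijection      = ψ
  ; edge-preserved = λ _ _ → refl
  ; arc-preserved  = λ _ _ → refl
  }

≅-comap-from : (ψ : V ↔ W) (H : MixedGraph V) → H ≅ comap (Inverse.from ψ) H
≅-comap-from ψ H = record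
  { bijection      = ψ
  ; edge-preserved = λ u v → sym (cong₂ (MixedGraph.edge H) (strictlyInverseʳ u) (strictlyInverseʳ v))
  ; arc-preserved  = λ u v → sym (cong₂ (MixedGraph.arc H) (strictlyInverseʳ u) (strictlyInverseʳ v))
  }
  where open Inverse ψ

-- Mixed graphs whose links form a balanced complete bipartite graph

module Bipartite (m : ℕ) where
  open SimpleGraph (K m m)

  K-triangle-free : ∀ {x y z} → Adj x y → Adj y z → ¬ Adj z x
  K-triangle-free {inj₁ _} {inj₂ _} {inj₁ _} _ _ ()
  K-triangle-free {inj₂ _} {inj₁ _} {inj₂ _} _ _ ()

  K-path-closes : ∀ {w x y z} → Adj w x → Adj x y → Adj y z → Adj z w
  K-path-closes {inj₁ _} {inj₂ _} {inj₁ _} {inj₂ _} _ _ _ = _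
  K-path-closes {inj₂ _} {inj₁ _} {inj₂ _} {inj₁ _} _ _ _ = _

  K-degree : ∀ a → HasSize (adj a) m
  K-degree (inj₁ _) = enumeration⇒HasSize inj₂ _ (λ { refl → refl })
    λ { {inj₁ _} () ; {inj₂ j} _ → j , refl }
  K-degree (inj₂ _) = enumeration⇒HasSize inj₁ _ (λ { refl → refl })
    λ { {inj₁ i} _ → i , refl ; {inj₂ _} () }

module _ {n r : ℕ} {H : MixedGraph (Fin n)} {M : MixedGraph (Fin (r + 2) ⊎ Fin (r + 2))} (H≅M : H ≅ M)
  (out-degree : ∀ u → HasSize (λ v → MixedGraph.arc M u v) 1)
  (in-degree  : ∀ u → HasSize (λ v → MixedGraph.arc M v u) 1)
  (link≡adj   : ∀ u v → link M u v ≡ SimpleGraph.adj (K (r + 2) (r + 2)) u v)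
  where
  open _≅_ H≅M
  open Inverse bijection using (to; from)
  open Bipartite (r + 2)
  private
    module H = MixedGraph H
    open SimpleGraph (K (r + 2) (r + 2)) using (adj; Adj)

    H-out : ∀ u → HasSize (λ v → H.arc u v) 1
    H-out u = HasSize-preimage bijection (λ v → arc-preserved u v) (out-degree (to u))

    H-in : ∀ u → HasSize (λ v → H.arc v u) 1
    H-in u = HasSize-preimage bijection (λ v → arc-preserved v u) (in-degree (to u))

    H-link : ∀ u v → link H u v ≡ adj (to u) (to v)
    H-link u v = trans
      (cong₂ _∨_ (edge-preserved u v) (cong₂ _∨_ (arc-preserved u v) (arc-preserved v u)))
      (link≡adj (to u) (to v))

    link⇒adj : ∀ {u v} → Link H u v → Adj (to u) (to v)
    link⇒adj {u} {v} = subst T (H-link u v)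

    adj⇒link : ∀ {u v} → Adj (to u) (to v) → Link H u v
    adj⇒link {u} {v} = subst T (sym (H-link u v))

    -- With `k` edges at `u`, counting the links at `u` in two ways gives `k + 2 ≡ r + 2`.
    H-edge : ∀ u → HasSize (λ v → H.edge u v) r
    H-edge u = let k , h = HasSize-Fin (H.edge u) in
      subst (HasSize (H.edge u)) (+-cancelʳ-≡ 2 k r (HasSize-unique
        (HasSize-∨ h (arcs-degree H H-out H-in u) (edge∩arcs=∅ H))
        (HasSize-preimage bijection (H-link u) (K-degree (to u))))) h

  ≅bipartite⇒regular : IsMixedRegular 1 r 4 H
  ≅bipartite⇒regular = record
    { out-degree  = H-out
    ; in-degree   = H-in
    ; edge-degree = H-edge
    -- Any vertex would do; `r ↑ʳ zero` inhabits `Fin (r + 2)` although `r + 2` does not reduce to a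
    -- successor.
    ; girth       = triangle-free⇒girth-4 H H-out H-in (from (inj₁ (r ↑ʳ zero)))
        (λ {x} {y} {z} xy yz zx →
          K-triangle-free {to x} {to y} {to z} (link⇒adj xy) (link⇒adj yz) (link⇒adj zx))
        (λ {w} {x} {y} {z} wx xy yz →
          adj⇒link (K-path-closes {to w} {to x} {to y} {to z} (link⇒adj wx) (link⇒adj xy) (link⇒adj yz)))
    }

  ≅bipartite⇒order : n ≡ (r + 2) + (r + 2)
  ≅bipartite⇒order = ↔⇒≡ (↔-sym +↔⊎ ↔-∘ bijection)

  -- The order equals the lower bound valid for every regular competitor.
  ≅bipartite⇒cage : IsMixedCage 1 r 4 H
  ≅bipartite⇒cage = ≅bipartite⇒regular , λ _ regular →
    ≤-trans (≤-reflexive ≅bipartite⇒order) (RegularLowerBound.order-bound regular)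

-- Existence: an explicit cage

-- This is the cyclic shift taking `i` to `i - 1` modulo `k + 1`.
rotation : ∀ k → Fin (suc k) ↔ Fin (suc k)
rotation k = mk↔ₛ′ to from to∘from from∘to
  where
  to : Fin (suc k) → Fin (suc k)
  to zero    = fromℕ k
  to (suc i) = inject₁ i

  from : Fin (suc k) → Fin (suc k)
  from i with view i
  ... | ‵fromℕ     = zero
  ... | ‵inject₁ j = suc j

  to∘from : ∀ i → to (from i) ≡ i
  to∘from i with view i
  ... | ‵fromℕ     = refl
  ... | ‵inject₁ j = refl

  from∘to : ∀ i → from (to i) ≡ i
  from∘to zero    rewrite view-fromℕ k   = refl
  from∘to (suc i) rewrite view-inject₁ i = refl

inject₁≢suc : ∀ {k} (i : Fin k) → inject₁ i ≢ suc i
inject₁≢suc (suc i) eq = inject₁≢suc i (suc-injective eq)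

-- A cyclic shift of at least two elements has no fixed point. It is built on `2 + r`, which exposes
-- the successors, and then transported.
derangement : ∀ r → Σ[ σ ∈ (Fin (r + 2) ↔ Fin (r + 2)) ] ∀ i → Inverse.to σ i ≢ i
derangement r = subst (λ m → Σ[ σ ∈ (Fin m ↔ Fin m) ] ∀ i → Inverse.to σ i ≢ i) (+-comm 2 r)
  (rotation (suc r) , λ { zero () ; (suc i) → inject₁≢suc i })

-- The arcs form the cycles inj₁ i → inj₂ i → inj₁ (σ i) → …; a fixed point of σ would give
-- two opposite arcs.
module Example {m : ℕ} (σ : Fin m ↔ Fin m) (σ-deranged : ∀ i → Inverse.to σ i ≢ i) where
  open Inverse σ

  arc₀ : Fin m ⊎ Fin m → Fin m ⊎ Fin m → Bool
  arc₀ (inj₁ i) (inj₂ j) = ⌊ i ≟ j ⌋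
  arc₀ (inj₂ j) (inj₁ i) = ⌊ to j ≟ i ⌋
  arc₀ (inj₁ _) (inj₁ _) = false
  arc₀ (inj₂ _) (inj₂ _) = false

  across : Fin m ⊎ Fin m → Fin m ⊎ Fin m → Bool
  across = SimpleGraph.adj (K m m)

  arcs₀ : Fin m ⊎ Fin m → Fin m ⊎ Fin m → Bool
  arcs₀ u v = arc₀ u v ∨ arc₀ v u

  edge₀ : Fin m ⊎ Fin m → Fin m ⊎ Fin m → Bool
  edge₀ u v = across u v ∧ not (arcs₀ u v)

  arc₀-asym : ∀ u v → T (arc₀ u v) → ¬ T (arc₀ v u)
  arc₀-asym (inj₁ i) (inj₂ j) a b =
    σ-deranged j (trans (toWitness {a? = to j ≟ i} b) (toWitness {a? = i ≟ j} a))
  arc₀-asym (inj₂ j) (inj₁ i) a b =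
    σ-deranged j (trans (toWitness {a? = to j ≟ i} a) (toWitness {a? = i ≟ j} b))

  edge₀-disjoint : ∀ g {a b} → T (g ∧ not (a ∨ b)) → ¬ T a
  edge₀-disjoint true {false} _ ()

  edge₀-sym : ∀ u v → edge₀ u v ≡ edge₀ v u
  edge₀-sym u v = cong₂ _∧_
    (T-⇔⇒≡ (sym′ {u} {v}) (sym′ {v} {u}))
    (cong not (∨-comm (arc₀ u v) (arc₀ v u)))
    where
    sym′ : ∀ {u v} → T (across u v) → T (across v u)
    sym′ {u} {v} = SimpleGraph.adj-sym (K m m) {u} {v}

  graph : MixedGraph (Fin m ⊎ Fin m)
  graph = record
    { edge        = edge₀
    ; arc         = arc₀
    ; edge-sym    = λ {u} {v} → subst T (edge₀-sym u v)
    ; edge-irrefl = λ { {inj₁ _} refl () ; {inj₂ _} refl () }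
    ; arc-asym    = λ {u} {v} → arc₀-asym u v
    ; disjoint    = λ {u} {v} → edge₀-disjoint (across u v)
    }

  link≡across : ∀ u v → link graph u v ≡ across u v
  link≡across u v = ∖-∨-cancel (across u v) (arcs₀ u v) (arcs₀⊆across u v)
    where
    arcs₀⊆across : ∀ u v → T (arcs₀ u v) → T (across u v)
    arcs₀⊆across (inj₁ _) (inj₂ _) _ = _
    arcs₀⊆across (inj₂ _) (inj₁ _) _ = _

  out-degree : ∀ u → HasSize (λ v → arc₀ u v) 1
  out-degree (inj₁ i) = ∃!⇒HasSize-1 {x = inj₂ i} (fromWitness {a? = i ≟ i} refl)
    λ { {inj₁ _} () ; {inj₂ j} a → cong inj₂ (toWitness {a? = i ≟ j} a) }
  out-degree (inj₂ j) = ∃!⇒HasSize-1 {x = inj₁ (to j)} (fromWitness {a? = to j ≟ to j} refl)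
    λ { {inj₂ _} () ; {inj₁ i} a → cong inj₁ (toWitness {a? = to j ≟ i} a) }

  in-degree : ∀ u → HasSize (λ v → arc₀ v u) 1
  in-degree (inj₁ i) = ∃!⇒HasSize-1 {x = inj₂ (from i)}
    (fromWitness {a? = to (from i) ≟ i} (strictlyInverseˡ i))
    λ { {inj₁ _} ()
      ; {inj₂ j} a →
          cong inj₂ (trans (cong from (sym (toWitness {a? = to j ≟ i} a))) (strictlyInverseʳ j)) }
  in-degree (inj₂ j) = ∃!⇒HasSize-1 {x = inj₁ j} (fromWitness {a? = j ≟ j} refl)
    λ { {inj₂ _} () ; {inj₁ i} a → cong inj₁ (sym (toWitness {a? = i ≟ j} a)) }

cage-exists : ∀ r → ∃[ H ] IsMixedCage 1 r 4 {2 * (r + 2)} H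
cage-exists r = comap (Inverse.to ψ) graph ,
  ≅bipartite⇒cage (comap-≅ ψ graph) out-degree in-degree link≡across
  where
  open Example (proj₁ (derangement r)) (proj₂ (derangement r))

  ψ : Fin (2 * (r + 2)) ↔ (Fin (r + 2) ⊎ Fin (r + 2))
  -- `2 * (r + 2)` unfolds to `(r + 2) + ((r + 2) + 0)`, so only the trailing zero has to be
  -- removed.
  ψ = subst (λ k → Fin ((r + 2) + k) ↔ (Fin (r + 2) ⊎ Fin (r + 2))) (sym (+-identityʳ (r + 2))) +↔⊎

-- Order and characterisation of the cages

twice : ∀ m → m + m ≡ 2 * m
twice m = cong (m +_) (sym (+-identityʳ m))

-- Minimality against the explicit cage bounds the order from above, and the two disjoint
-- neighbourhoods bound it from below.
cage-order : ∀ {r n} (H : MixedGraph (Fin n)) → IsMixedCage 1 r 4 H → n ≡ (r + 2) + (r + 2)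
cage-order {r} H (regular , minimal) = ≤-antisym
  (≤-trans (minimal _ (proj₁ (proj₂ (cage-exists r)))) (≤-reflexive (sym (twice (r + 2)))))
  (RegularLowerBound.order-bound regular)

module _ {n r : ℕ} {H : MixedGraph (Fin n)} (regular : IsMixedRegular 1 r 4 H)
  (ψ : Fin n ↔ (Fin (r + 2) ⊎ Fin (r + 2)))
  (link≡adj : ∀ a b → link H (Inverse.from ψ a) (Inverse.from ψ b) ≡
    SimpleGraph.adj (K (r + 2) (r + 2)) a b)
  where
  open IsMixedRegular regular
  private
    M : MixedGraph (Fin (r + 2) ⊎ Fin (r + 2))
    M = comap (Inverse.from ψ) H

    F : SimpleGraph (Fin (r + 2) ⊎ Fin (r + 2))
    F = record
      { adj        = arcs M
      ; adj-sym    = λ {u} {v} → arcs-sym M {u} {v}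
      ; adj-irrefl = λ { {u} refl → arcs-irrefl M {u} }
      }

    M-out : ∀ u → HasSize (λ v → MixedGraph.arc M u v) 1
    M-out u = HasSize-preimage (↔-sym ψ) (λ _ → refl) (out-degree (Inverse.from ψ u))

    M-in : ∀ u → HasSize (λ v → MixedGraph.arc M v u) 1
    M-in u = HasSize-preimage (↔-sym ψ) (λ _ → refl) (in-degree (Inverse.from ψ u))

  -- Relabelling along `ψ` makes the links of `M` those of the complete bipartite graph. Taking its
  -- arcs, stripped of direction, as `F` makes `arcs-orient` true by definition.
  regular∧bipartite⇒oriented : ObtainedByOrienting (K (r + 2) (r + 2)) H
  regular∧bipartite⇒oriented = F , M , orientation , ≅-comap-from ψ H
    where
    orientation : IsFactorOrientation (K (r + 2) (r + 2)) F M
    orientation = record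
      { two-factor = record
        { subgraph    = λ {u} {v} a → subst T (link≡adj u v) (T-∨⁺ (MixedGraph.edge M u v) (inj₂ a))
        ; two-regular = arcs-degree M M-out M-in
        }
      ; arcs-orient     = λ _ _ → refl
      ; cycles-directed = λ w c → non-backtracking⇒directed M M-out M-in F (λ _ _ → refl) w
          (MixedGraph.IsCycle.distinct-links c)
      ; edges-remaining = λ u v →
          trans (edge≡link∖arcs M u v) (cong (_∧ not (arcs M u v)) (link≡adj u v))
      }

cage⇒oriented : ∀ {r n} (H : MixedGraph (Fin n)) → IsMixedCage 1 r 4 H →
  ObtainedByOrienting (K (r + 2) (r + 2)) H
cage⇒oriented H cage@(regular , _) =
  let ψ , link≡adj = RegularLowerBound.complete-bipartite regular (cage-order H cage) in
  regular∧bipartite⇒oriented regular ψ link≡adj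

oriented⇒cage : ∀ {r n} (H : MixedGraph (Fin n)) → ObtainedByOrienting (K (r + 2) (r + 2)) H →
  IsMixedCage 1 r 4 H
oriented⇒cage H (_ , _ , orientation , H≅M) = ≅bipartite⇒cage H≅M out-degree in-degree link≡adj
  where open Oriented (↔-sym +↔⊎) orientation

theorem3 : (r : ℕ) → 1 ≤ r →
    (∃[ H ] IsMixedCage 1 r 4 {2 * (r + 2)} H) ×
    (∀ {n} (H : MixedGraph (Fin n)) → IsMixedCage 1 r 4 H → n ≡ 2 * (r + 2)) ×
    (∀ {n} (H : MixedGraph (Fin n)) → IsMixedCage 1 r 4 H ⇔ ObtainedByOrienting (K (r + 2) (r + 2)) H)
theorem3 r _ =
  cage-exists r ,
  (λ H cage → trans (cage-order H cage) (twice (r + 2))) ,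
  (λ H → mk⇔ (cage⇒oriented H) (oriented⇒cage H))
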